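{- Let $n$ be a positive integer and let $g_k(x)=\sum_{j=0}^{k}\binom{k}{j}^2\binom{2j}{j}x^j$ denote the Sun polynomials. Then (i) $\displaystyle \frac{1}{n}\sum_{k=0}^{n-1}(4k+3)g_k(x)\in\mathbb{Z}[x]$, i.e. every coefficient of the polynomial $\sum_{k=0}^{n-1}(4k+3)g_k(x)$ is divisible by $n$; (ii) $\displaystyle \sum_{k=0}^{n-1}(8k^2+12k+5)g_k(-1)\equiv 0\pmod{n}$.
   Context: The Sun polynomials are $g_k(x)=\sum_{j=0}^{k}\binom{k}{j}^2\binom{2j}{j}x^j$ for integers $k\ge 0$. -}

module Defs where

open import Data.Integer.Base as ℤ using (ℤ; +_; 0ℤ)
open import Data.List.Base using (List; []; _∷_; map; replicate; _∷ʳ_)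
open import Data.Nat.Base as ℕ using (ℕ; zero; suc)
open import Data.Nat.Combinatorics using (_C_)

infixl 6 _+ₚ_
infixr 7 _·ₚ_

-- Coefficient lists, constant term first. Trailing zeros are allowed, so a
-- polynomial has several representatives; coeff and eval do not depend on
-- the one chosen.
ℤ[x] : Set
ℤ[x] = List ℤ

coeff : ℤ[x] → ℕ → ℤ
coeff []      _       = 0ℤ
coeff (a ∷ p) zero    = a
coeff (a ∷ p) (suc m) = coeff p m

eval : ℤ[x] → ℤ → ℤ
eval []      t = 0ℤ
eval (a ∷ p) t = a ℤ.+ t ℤ.* eval p t

_+ₚ_ : ℤ[x] → ℤ[x] → ℤ[x]
[]      +ₚ q       = q
(a ∷ p) +ₚ []      = a ∷ p
(a ∷ p) +ₚ (b ∷ q) = (a ℤ.+ b) ∷ (p +ₚ q)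

_·ₚ_ : ℤ → ℤ[x] → ℤ[x]
c ·ₚ p = map (c ℤ.*_) p

x^_ : ℕ → ℤ[x]
x^ j = replicate j 0ℤ ∷ʳ ℤ.1ℤ

-- Both sums run over 0 ≤ k < n.
∑ : ℕ → (ℕ → ℤ) → ℤ
∑ zero    f = 0ℤ
∑ (suc n) f = ∑ n f ℤ.+ f n

∑ₚ : ℕ → (ℕ → ℤ[x]) → ℤ[x]
∑ₚ zero    f = []
∑ₚ (suc n) f = ∑ₚ n f +ₚ f n

g : ℕ → ℤ[x]
g k = ∑ₚ (suc k) λ j → + ((k C j) ℕ.^ 2 ℕ.* ((2 ℕ.* j) C j)) ·ₚ (x^ j)

-- The x^m-coefficient of g k is s(k) = C(2m,m) C(k,m)², and Vandermonde's identity
-- gives its Newton expansion s(k) = Σ_l a(m,l) C(k,l) with a(m,l) = C(l,m)² C(2m,l).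
-- Summation over k and (l+1) C(n,l+1) ≡ 0 (mod n) turn the two weighted sums of s into
--   Σ_l c(m,l) C(n,l+1)  (mod n),
-- where c(m,l) = - a(m,l) - 4 a(m,l-1) for the weight 4k+3, and
-- c(m,l) = a(m,l) + 12 a(m,l-1) + 16 a(m,l-2) for the weight 8k²+12k+5.  Such a sum
-- vanishes mod n when l+1 divides every c(m,l), as it does for the first weight.
-- For the second one c(m,l) ≡ m² a(m,l) + (m+1)² a(m+1,l)  (mod l+1), and this
-- telescopes in the alternating sum over m that computes g k (-1).

module Submission where

open import Defs

module _ where

  open import Data.Integer.Base using (ℤ; +_; 0ℤ; 1ℤ; -1ℤ; _+_; _-_; -_; _*_; _^_)
  open import Data.Integer.Divisibility.Signed
  open import Data.Integer.Properties
  open import Data.Integer.Tactic.RingSolver using (solve-∀)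
  open import Data.List.Base using ([]; _∷_)
  open import Data.Nat.Base as ℕ using (ℕ; zero; suc; z<s; s<s)
  open import Data.Nat.Combinatorics using (_C_; k>n⇒nCk≡0; nC1≡n; nCk+nC[k+1]≡[n+1]C[k+1]; nCk≡nC[n∸k])
  import Data.Nat.Properties as ℕ
  open import Data.Product.Base using (_,_)
  open import Data.Sum.Base using (inj₁; inj₂)
  open import Relation.Binary.PropositionalEquality
  open import Relation.Nullary.Negation.Core using (contradiction)
  open import Algebra.Properties.AbelianGroup +-0-abelianGroup using (∙-cancelʳ)
  open ≡-Reasoning

  -- Finite sums of integers.

  ∑-cong : ∀ n {f h} → (∀ {k} → k ℕ.< n → f k ≡ h k) → ∑ n f ≡ ∑ n h
  ∑-cong zero    f≗h = refl
  ∑-cong (suc n) f≗h = cong₂ _+_ (∑-cong n (λ k<n → f≗h (ℕ.m<n⇒m<1+n k<n))) (f≗h (ℕ.n<1+n n))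

  ∑-zero : ∀ n {f} → (∀ {k} → k ℕ.< n → f k ≡ 0ℤ) → ∑ n f ≡ 0ℤ
  ∑-zero zero    f≗0 = refl
  ∑-zero (suc n) f≗0 = cong₂ _+_ (∑-zero n (λ k<n → f≗0 (ℕ.m<n⇒m<1+n k<n))) (f≗0 (ℕ.n<1+n n))

  ∑-+ : ∀ n f h → ∑ n (λ k → f k + h k) ≡ ∑ n f + ∑ n h
  ∑-+ zero    f h = refl
  ∑-+ (suc n) f h = trans (cong (λ z → z + (f n + h n)) (∑-+ n f h)) (swap (∑ n f) (∑ n h) (f n) (h n))
    where
    swap : ∀ a b c d → a + b + (c + d) ≡ a + c + (b + d)
    swap = solve-∀

  ∑-- : ∀ n (f h : ℕ → ℤ) → ∑ n (λ k → f k - h k) ≡ ∑ n f - ∑ n h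
  ∑-- zero    f h = refl
  ∑-- (suc n) f h = trans (cong (λ z → z + (f n - h n)) (∑-- n f h)) (swap (∑ n f) (∑ n h) (f n) (h n))
    where
    swap : ∀ a b c d → a - b + (c - d) ≡ a + c - (b + d)
    swap = solve-∀

  ∑-*ˡ : ∀ n c f → ∑ n (λ k → c * f k) ≡ c * ∑ n f
  ∑-*ˡ zero    c f = sym (*-zeroʳ c)
  ∑-*ˡ (suc n) c f = trans (cong (λ z → z + c * f n) (∑-*ˡ n c f)) (sym (*-distribˡ-+ c (∑ n f) (f n)))

  ∑-comm : ∀ m n (f : ℕ → ℕ → ℤ) → ∑ m (λ i → ∑ n (f i)) ≡ ∑ n (λ j → ∑ m (λ i → f i j))
  ∑-comm zero    n f = sym (∑-zero n (λ _ → refl))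
  ∑-comm (suc m) n f = trans (cong (λ z → z + ∑ n (f m)) (∑-comm m n f)) (sym (∑-+ n _ (f m)))

  ∑-split : ∀ m n f → ∑ (m ℕ.+ n) f ≡ ∑ m f + ∑ n (λ k → f (m ℕ.+ k))
  ∑-split m zero    f = trans (cong (λ s → ∑ s f) (ℕ.+-identityʳ m)) (sym (+-identityʳ _))
  ∑-split m (suc n) f = begin
    ∑ (m ℕ.+ suc n) f                                        ≡⟨ cong (λ s → ∑ s f) (ℕ.+-suc m n) ⟩
    ∑ (m ℕ.+ n) f + f (m ℕ.+ n)                              ≡⟨ cong (λ z → z + f (m ℕ.+ n)) (∑-split m n f) ⟩
    ∑ m f + ∑ n (λ k → f (m ℕ.+ k)) + f (m ℕ.+ n)            ≡⟨ +-assoc (∑ m f) _ _ ⟩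
    ∑ m f + ∑ (suc n) (λ k → f (m ℕ.+ k))                    ∎

  ∑-extend : ∀ {m n} f → m ℕ.≤ n → (∀ {k} → m ℕ.≤ k → f k ≡ 0ℤ) → ∑ m f ≡ ∑ n f
  ∑-extend {m} {n} f m≤n f≗0 = begin
    ∑ m f                                             ≡⟨ +-identityʳ _ ⟨
    ∑ m f + 0ℤ                                        ≡⟨ cong (λ z → ∑ m f + z) (∑-zero (n ℕ.∸ m) (λ _ → f≗0 (ℕ.m≤m+n m _))) ⟨
    ∑ m f + ∑ (n ℕ.∸ m) (λ k → f (m ℕ.+ k))           ≡⟨ ∑-split m (n ℕ.∸ m) f ⟨
    ∑ (m ℕ.+ (n ℕ.∸ m)) f                             ≡⟨ cong (λ s → ∑ s f) (ℕ.m+[n∸m]≡n m≤n) ⟩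
    ∑ n f                                             ∎

  ∑-∣ : ∀ d n {f} → (∀ k → d ∣ f k) → d ∣ ∑ n f
  ∑-∣ d zero    d∣f = divides 0ℤ refl
  ∑-∣ d (suc n) d∣f = ∣m∣n⇒∣m+n (∑-∣ d n d∣f) (d∣f n)

  -- With alternating signs the second half of each summand cancels the first half of the next, so
  -- only the two ends survive. This performs the cancellation over m at the point -1.
  ∑-alternating : ∀ n (f : ℕ → ℤ) → ∑ n (λ k → -1ℤ ^ k * (f k + f (suc k))) ≡ f 0 - -1ℤ ^ n * f n
  ∑-alternating zero    f = base (f 0)
    where
    base : ∀ x → 0ℤ ≡ x - 1ℤ * x
    base = solve-∀
  ∑-alternating (suc n) f = trans (cong (λ z → z + -1ℤ ^ n * (f n + f (suc n))) (∑-alternating n f)) (step (f 0) (-1ℤ ^ n) (f n) (f (suc n)))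
    where
    step : ∀ x s y z → x - s * y + s * (y + z) ≡ x - -1ℤ * s * z
    step = solve-∀

  -- The index shift l ↦ l-1. The value 0 at the start stands for the coefficient at index -1, so
  -- formulas in a(m,l-1) and a(m,l-2) need no case distinction.
  prev : (ℕ → ℤ) → ℕ → ℤ
  prev f zero    = 0ℤ
  prev f (suc l) = f l

  -- Reindexing by one: the new bottom term vanishes by the default value of `prev`, and the extra
  -- top term vanishes by the hypothesis on `h n`.
  ∑-prev : ∀ n (f h : ℕ → ℤ) → h n ≡ 0ℤ → ∑ n (λ l → f l * h (suc l)) ≡ ∑ n (λ l → prev f l * h l)
  ∑-prev n f h hn≡0 = begin
    ∑ n (λ l → f l * h (suc l))           ≡⟨ shift n ⟩
    S + prev f n * h n                    ≡⟨ cong (λ z → S + prev f n * z) hn≡0 ⟩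
    S + prev f n * 0ℤ                     ≡⟨ cong (λ z → S + z) (*-zeroʳ (prev f n)) ⟩
    S + 0ℤ                                ≡⟨ +-identityʳ S ⟩
    S                                     ∎
    where
    S = ∑ n (λ l → prev f l * h l)
    shift : ∀ n → ∑ n (λ l → f l * h (suc l)) ≡ ∑ (suc n) (λ l → prev f l * h l)
    shift zero    = refl
    shift (suc n) = cong (λ z → z + f n * h (suc n)) (shift n)

  -- Binomial coefficients

  -- Opaque, since unification would otherwise unfold products of binomials.
  opaque

    binom : ℕ → ℕ → ℤ
    binom n k = + (n C k)

    binom-def : ∀ n k → binom n k ≡ + (n C k)
    binom-def n k = refl

    n<k⇒binom≡0 : ∀ {n k} → n ℕ.< k → binom n k ≡ 0ℤ
    n<k⇒binom≡0 n<k = cong +_ (k>n⇒nCk≡0 n<k)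

    binom-0 : ∀ n → binom n 0 ≡ 1ℤ
    binom-0 n = refl

    binom-1 : ∀ n → binom n 1 ≡ + n
    binom-1 n = cong +_ (nC1≡n n)

    pascal : ∀ n k → binom (suc n) (suc k) ≡ binom n k + binom n (suc k)
    pascal n k = cong +_ (sym (nCk+nC[k+1]≡[n+1]C[k+1] n k))

    binom-sym : ∀ m n → binom (m ℕ.+ n) m ≡ binom (m ℕ.+ n) n
    binom-sym m n = cong +_ (trans (nCk≡nC[n∸k] (ℕ.m≤m+n m n)) (cong (λ k → (m ℕ.+ n) C k) (ℕ.m+n∸m≡n m n)))

  -- Induction through Pascal's rule. Over the integers the factor n - k is not truncated, so the
  -- recurrence needs no side condition: for k > n both binomials are 0.
  binom-sucʳ : ∀ n k → (1ℤ + + k) * binom n (suc k) ≡ (+ n - + k) * binom n k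
  binom-sucʳ n zero = begin
    1ℤ * binom n 1             ≡⟨ cong (λ z → 1ℤ * z) (binom-1 n) ⟩
    1ℤ * + n                   ≡⟨ identity (+ n) ⟩
    (+ n - 0ℤ) * 1ℤ            ≡⟨ cong (λ z → (+ n - 0ℤ) * z) (binom-0 n) ⟨
    (+ n - 0ℤ) * binom n 0     ∎
    where
    identity : ∀ n → 1ℤ * n ≡ (n - 0ℤ) * 1ℤ
    identity = solve-∀
  binom-sucʳ zero (suc k) =
    trans (cong (λ z → (1ℤ + + suc k) * z) (n<k⇒binom≡0 {0} {suc (suc k)} z<s))
      (trans (*-zeroʳ (1ℤ + + suc k))
        (sym (trans (cong (λ z → (0ℤ - + suc k) * z) (n<k⇒binom≡0 {0} {suc k} z<s)) (*-zeroʳ (0ℤ - + suc k)))))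
  binom-sucʳ (suc n) (suc k) = begin
    (1ℤ + + suc k) * binom (suc n) (suc (suc k))   ≡⟨ cong (λ z → (1ℤ + + suc k) * z) (pascal n (suc k)) ⟩
    (1ℤ + + suc k) * (y + z)                       ≡⟨ *-distribˡ-+ (1ℤ + + suc k) y z ⟩
    (1ℤ + + suc k) * y + (1ℤ + + suc k) * z        ≡⟨ cong (λ z → (1ℤ + + suc k) * y + z) (binom-sucʳ n (suc k)) ⟩
    (1ℤ + + suc k) * y + (+ n - + suc k) * y       ≡⟨ regroup (+ n) (+ k) y ⟩
    (1ℤ + + k) * y + (+ n - + k) * y               ≡⟨ cong (λ z → z + (+ n - + k) * y) (binom-sucʳ n k) ⟩
    (+ n - + k) * x + (+ n - + k) * y              ≡⟨ *-distribˡ-+ (+ n - + k) x y ⟨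
    (+ n - + k) * (x + y)                          ≡⟨ cong₂ _*_ (cancel (+ n) (+ k)) (pascal n k) ⟨
    (+ suc n - + suc k) * binom (suc n) (suc k)    ∎
    where
    x = binom n k
    y = binom n (suc k)
    z = binom n (suc (suc k))
    regroup : ∀ n k y → (1ℤ + (1ℤ + k)) * y + (n - (1ℤ + k)) * y ≡ (1ℤ + k) * y + (n - k) * y
    regroup = solve-∀
    cancel : ∀ n k → 1ℤ + n - (1ℤ + k) ≡ n - k
    cancel = solve-∀

  absorption : ∀ n k → (1ℤ + + k) * binom (suc n) (suc k) ≡ (1ℤ + + n) * binom n k
  absorption n k = begin
    (1ℤ + + k) * binom (suc n) (suc k)                            ≡⟨ cong (λ z → (1ℤ + + k) * z) (pascal n k) ⟩
    (1ℤ + + k) * (binom n k + binom n (suc k))                    ≡⟨ *-distribˡ-+ (1ℤ + + k) (binom n k) (binom n (suc k)) ⟩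
    (1ℤ + + k) * binom n k + (1ℤ + + k) * binom n (suc k)         ≡⟨ cong (λ z → (1ℤ + + k) * binom n k + z) (binom-sucʳ n k) ⟩
    (1ℤ + + k) * binom n k + (+ n - + k) * binom n k              ≡⟨ identity (+ n) (+ k) (binom n k) ⟩
    (1ℤ + + n) * binom n k                                        ∎
    where
    identity : ∀ n k x → (1ℤ + k) * x + (n - k) * x ≡ (1ℤ + n) * x
    identity = solve-∀

  binom-sucˡ : ∀ n k → (1ℤ + + n - + k) * binom (suc n) k ≡ (1ℤ + + n) * binom n k
  binom-sucˡ n k = begin
    (1ℤ + + n - + k) * binom (suc n) k             ≡⟨ binom-sucʳ (suc n) k ⟨
    (1ℤ + + k) * binom (suc n) (suc k)             ≡⟨ absorption n k ⟩
    (1ℤ + + n) * binom n k                         ∎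

  -- Both sides count pairs of nested subsets. The induction on m multiplies by m+1, moves this
  -- factor through three uses of `absorption`, and cancels it again. Writing n = m + d and l = m +
  -- i avoids subtraction.
  trinomial-revision : ∀ m d i →
    binom (m ℕ.+ d) m * binom d i ≡ binom (m ℕ.+ d) (m ℕ.+ i) * binom (m ℕ.+ i) m
  trinomial-revision zero d i = begin
    binom d 0 * binom d i     ≡⟨ cong (λ z → z * binom d i) (binom-0 d) ⟩
    1ℤ * binom d i            ≡⟨ *-comm 1ℤ (binom d i) ⟩
    binom d i * 1ℤ            ≡⟨ cong (λ z → binom d i * z) (binom-0 i) ⟨
    binom d i * binom i 0     ∎
  trinomial-revision (suc m) d i = *-cancelˡ-≡ (+ suc m) (A′ * D) (P′ * Q′) (begin
    u * (A′ * D)    ≡⟨ *-assoc u A′ D ⟨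
    u * A′ * D      ≡⟨ cong (λ z → z * D) (absorption (m ℕ.+ d) m) ⟩
    v * A * D       ≡⟨ *-assoc v A D ⟩
    v * (A * D)     ≡⟨ cong (λ z → v * z) (trinomial-revision m d i) ⟩
    v * (P * Q)     ≡⟨ *-assoc v P Q ⟨
    v * P * Q       ≡⟨ cong (λ z → z * Q) (absorption (m ℕ.+ d) (m ℕ.+ i)) ⟨
    w * P′ * Q      ≡⟨ rotate w P′ Q ⟩
    P′ * (w * Q)    ≡⟨ cong (λ z → P′ * z) (absorption (m ℕ.+ i) m) ⟨
    P′ * (u * Q′)   ≡⟨ rotate u P′ Q′ ⟨
    u * P′ * Q′     ≡⟨ *-assoc u P′ Q′ ⟩
    u * (P′ * Q′)   ∎)
    where
    u = 1ℤ + + m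
    v = 1ℤ + + (m ℕ.+ d)
    w = 1ℤ + + (m ℕ.+ i)
    D = binom d i
    A = binom (m ℕ.+ d) m
    A′ = binom (suc m ℕ.+ d) (suc m)
    P = binom (m ℕ.+ d) (m ℕ.+ i)
    P′ = binom (suc m ℕ.+ d) (suc m ℕ.+ i)
    Q = binom (m ℕ.+ i) m
    Q′ = binom (suc m ℕ.+ i) (suc m)
    rotate : ∀ a b c → a * b * c ≡ b * (a * c)
    rotate = solve-∀

  -- Pascal's rule in the upper argument: the part with lower index i-1 is reindexed, which shortens
  -- its range by one.
  ∑-binom-suc : ∀ d n (f : ℕ → ℤ) → ∑ (suc n) (λ i → binom (suc d) i * f i) ≡
    ∑ (suc n) (λ i → binom d i * f i) + ∑ n (λ i → binom d i * f (suc i))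
  ∑-binom-suc d zero    f = trans (cong (λ z → 0ℤ + z * f 0) (trans (binom-0 (suc d)) (sym (binom-0 d)))) (sym (+-identityʳ _))
  ∑-binom-suc d (suc n) f = begin
    ∑ (suc n) (λ i → binom (suc d) i * f i) + binom (suc d) (suc n) * f (suc n)
      ≡⟨ cong₂ _+_ (∑-binom-suc d n f) (cong (λ z → z * f (suc n)) (pascal d n)) ⟩
    S + T + (binom d n + binom d (suc n)) * f (suc n)
      ≡⟨ regroup S T (binom d n) (binom d (suc n)) (f (suc n)) ⟩
    S + binom d (suc n) * f (suc n) + (T + binom d n * f (suc n)) ∎
    where
    S = ∑ (suc n) (λ i → binom d i * f i)
    T = ∑ n (λ i → binom d i * f (suc i))
    regroup : ∀ s t x y z → s + t + (x + y) * z ≡ s + y * z + (t + x * z)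
    regroup = solve-∀

  -- This is the usual convolution after C(d,i) = C(d,d-i). The offset q is general because the
  -- induction on d raises it by one in the second sum. Any range containing all i ≤ d is allowed,
  -- since `∑-binom-suc` yields sums of two different lengths.
  vandermonde : ∀ m d q {n} → d ℕ.< n →
    ∑ n (λ i → binom d i * binom m (q ℕ.+ i)) ≡ binom (d ℕ.+ m) (d ℕ.+ q)
  vandermonde m zero q {suc n} _ = begin
    ∑ (suc n) (λ i → binom 0 i * binom m (q ℕ.+ i))
      ≡⟨ ∑-split 1 n _ ⟩
    0ℤ + binom 0 0 * binom m (q ℕ.+ 0) + ∑ n (λ i → binom 0 (suc i) * binom m (q ℕ.+ suc i))
      ≡⟨ cong₂ _+_ (trans (cong (λ z → 0ℤ + z * binom m (q ℕ.+ 0)) (binom-0 0)) (identity (binom m (q ℕ.+ 0))))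
           (∑-zero n (λ {i} _ → cong (λ z → z * binom m (q ℕ.+ suc i)) (n<k⇒binom≡0 {0} {suc i} z<s))) ⟩
    binom m (q ℕ.+ 0) + 0ℤ
      ≡⟨ +-identityʳ _ ⟩
    binom m (q ℕ.+ 0)
      ≡⟨ cong (binom m) (ℕ.+-identityʳ q) ⟩
    binom m q ∎
    where
    identity : ∀ x → 0ℤ + 1ℤ * x ≡ x
    identity = solve-∀
  vandermonde m (suc d) q {suc n} (s<s d<n) = begin
    ∑ (suc n) (λ i → binom (suc d) i * binom m (q ℕ.+ i))
      ≡⟨ ∑-binom-suc d n (λ i → binom m (q ℕ.+ i)) ⟩
    ∑ (suc n) (λ i → binom d i * binom m (q ℕ.+ i)) + ∑ n (λ i → binom d i * binom m (q ℕ.+ suc i))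
      ≡⟨ cong₂ _+_ (vandermonde m d q (ℕ.m<n⇒m<1+n d<n))
           (∑-cong n (λ {i} _ → cong (λ j → binom d i * binom m j) (ℕ.+-suc q i))) ⟩
    binom (d ℕ.+ m) (d ℕ.+ q) + ∑ n (λ i → binom d i * binom m (suc q ℕ.+ i))
      ≡⟨ cong (λ z → binom (d ℕ.+ m) (d ℕ.+ q) + z) (vandermonde m d (suc q) d<n) ⟩
    binom (d ℕ.+ m) (d ℕ.+ q) + binom (d ℕ.+ m) (d ℕ.+ suc q)
      ≡⟨ cong (λ j → binom (d ℕ.+ m) (d ℕ.+ q) + binom (d ℕ.+ m) j) (ℕ.+-suc d q) ⟩
    binom (d ℕ.+ m) (d ℕ.+ q) + binom (d ℕ.+ m) (suc (d ℕ.+ q))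
      ≡⟨ pascal (d ℕ.+ m) (d ℕ.+ q) ⟨
    binom (suc d ℕ.+ m) (suc d ℕ.+ q) ∎

  -- The last premise is left to the ring solver, which cannot use p ≡ r itself.
  by-adding : ∀ {x y p r} c → p ≡ r → x + c * p ≡ y + c * r → x ≡ y
  by-adding {x} {y} {p} c refl = ∙-cancelʳ (c * p) x y

  -- Coefficients of the Sun polynomials and their Newton expansion.

  sunCoeff : ℕ → ℕ → ℤ
  sunCoeff k j = binom (2 ℕ.* j) j * (binom k j * binom k j)

  k<j⇒sunCoeff≡0 : ∀ {k j} → k ℕ.< j → sunCoeff k j ≡ 0ℤ
  k<j⇒sunCoeff≡0 {k} {j} k<j =
    trans (cong (λ z → binom (2 ℕ.* j) j * (z * z)) (n<k⇒binom≡0 k<j)) (*-zeroʳ (binom (2 ℕ.* j) j))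

  linearWeight : ℕ → ℤ
  linearWeight k = + (4 ℕ.* k ℕ.+ 3)

  quadraticWeight : ℕ → ℤ
  quadraticWeight k = + (8 ℕ.* k ℕ.^ 2 ℕ.+ 12 ℕ.* k ℕ.+ 5)

  -- The l-th Newton coefficient of k ↦ sunCoeff k m, with C(2m,m) C(l,m) C(m,l-m)
  -- rewritten so that no subtraction occurs.
  newton : ℕ → ℕ → ℤ
  newton m l = binom l m * binom l m * binom (2 ℕ.* m) l

  l<m⇒newton≡0 : ∀ {m l} → l ℕ.< m → newton m l ≡ 0ℤ
  l<m⇒newton≡0 {m} {l} l<m = cong (λ z → z * z * binom (2 ℕ.* m) l) (n<k⇒binom≡0 l<m)

  -- For k = m + d, Vandermonde expands just one of the two factors C(k,m) as Σ_i C(d,i) C(m,i). Two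
  -- trinomial revisions then absorb C(d,i) and C(m,i) into C(k,m+i) and C(2m,m+i), each leaving a
  -- factor C(m+i,m); the index is l = m + i. For k < m every product vanishes.
  newton-expansion : ∀ m {k n} → k ℕ.< n → sunCoeff k m ≡ ∑ n (λ l → newton m l * binom k l)
  newton-expansion m {k} {n} k<n with ℕ.<-≤-connex k m
  ... | inj₁ k<m = begin
    sunCoeff k m                         ≡⟨ k<j⇒sunCoeff≡0 k<m ⟩
    0ℤ                                   ≡⟨ ∑-zero n (λ {l} _ → vanish l) ⟨
    ∑ n (λ l → newton m l * binom k l)   ∎
    where
    vanish : ∀ l → newton m l * binom k l ≡ 0ℤ
    vanish l with ℕ.≤-<-connex l k
    ... | inj₁ l≤k = cong (λ z → z * binom k l) (l<m⇒newton≡0 (ℕ.≤-<-trans l≤k k<m))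
    ... | inj₂ k<l = trans (cong (λ z → newton m l * z) (n<k⇒binom≡0 k<l)) (*-zeroʳ (newton m l))
  ... | inj₂ m≤k with ℕ.m≤n⇒∃[o]m+o≡n m≤k | ℕ.m≤n⇒∃[o]m+o≡n (ℕ.≤-trans m≤k (ℕ.<⇒≤ k<n))
  ... | d , refl | p , refl = begin
    M * (X * X)
      ≡⟨ *-assoc M X X ⟨
    M * X * X
      ≡⟨ cong (λ z → M * X * z) X≡∑ ⟩
    M * X * ∑ p (λ i → binom d i * binom m i)
      ≡⟨ ∑-*ˡ p (M * X) _ ⟨
    ∑ p (λ i → M * X * (binom d i * binom m i))
      ≡⟨ ∑-cong p (λ {i} _ → term i) ⟩
    ∑ p (λ i → newton m (m ℕ.+ i) * binom (m ℕ.+ d) (m ℕ.+ i))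
      ≡⟨ +-identityˡ _ ⟨
    0ℤ + ∑ p (λ i → newton m (m ℕ.+ i) * binom (m ℕ.+ d) (m ℕ.+ i))
      ≡⟨ cong (λ z → z + ∑ p (λ i → newton m (m ℕ.+ i) * binom (m ℕ.+ d) (m ℕ.+ i)))
           (∑-zero m (λ {l} l<m → cong (λ z → z * binom (m ℕ.+ d) l) (l<m⇒newton≡0 l<m))) ⟨
    ∑ m (λ l → newton m l * binom (m ℕ.+ d) l) + ∑ p (λ i → newton m (m ℕ.+ i) * binom (m ℕ.+ d) (m ℕ.+ i))
      ≡⟨ ∑-split m p (λ l → newton m l * binom (m ℕ.+ d) l) ⟨
    ∑ (m ℕ.+ p) (λ l → newton m l * binom (m ℕ.+ d) l) ∎
    where
    M = binom (2 ℕ.* m) m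
    X = binom (m ℕ.+ d) m
    X≡∑ : X ≡ ∑ p (λ i → binom d i * binom m i)
    X≡∑ = begin
      binom (m ℕ.+ d) m               ≡⟨ binom-sym m d ⟩
      binom (m ℕ.+ d) d               ≡⟨ cong₂ binom (ℕ.+-comm m d) (sym (ℕ.+-identityʳ d)) ⟩
      binom (d ℕ.+ m) (d ℕ.+ 0)       ≡⟨ vandermonde m d 0 (ℕ.+-cancelˡ-< m d p k<n) ⟨
      ∑ p (λ i → binom d i * binom m i) ∎
    -- The term `2 * m` reduces to `m + (m + 0)`, so the revision for m + m is transported along
    -- `m ≡ m + 0`.
    M-revision : ∀ i → M * binom m i ≡ binom (2 ℕ.* m) (m ℕ.+ i) * binom (m ℕ.+ i) m
    M-revision i = subst (λ s → binom (m ℕ.+ s) m * binom m i ≡ binom (m ℕ.+ s) (m ℕ.+ i) * binom (m ℕ.+ i) m)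
      (sym (ℕ.+-identityʳ m)) (trinomial-revision m m i)
    term : ∀ i → M * X * (binom d i * binom m i) ≡ newton m (m ℕ.+ i) * binom (m ℕ.+ d) (m ℕ.+ i)
    term i = begin
      M * X * (D * E)        ≡⟨ regroup M X D E ⟩
      M * E * (X * D)        ≡⟨ cong₂ _*_ (M-revision i) (trinomial-revision m d i) ⟩
      R * Q * (P * Q)        ≡⟨ regroup′ R Q P ⟩
      Q * Q * R * P          ∎
      where
      D = binom d i
      E = binom m i
      P = binom (m ℕ.+ d) (m ℕ.+ i)
      Q = binom (m ℕ.+ i) m
      R = binom (2 ℕ.* m) (m ℕ.+ i)
      regroup : ∀ a b c d → a * b * (c * d) ≡ a * d * (b * c)
      regroup = solve-∀
      regroup′ : ∀ r q p → r * q * (p * q) ≡ q * q * r * p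
      regroup′ = solve-∀

  -- Weighted sums of binomial coefficients modulo n.

  ∣-respʳ-≡ : ∀ {d x y} → x ≡ y → d ∣ y → d ∣ x
  ∣-respʳ-≡ {d} x≡y = subst (d ∣_) (sym x≡y)

  n∣[1+l]binom : ∀ n l → + n ∣ (1ℤ + + l) * binom n (suc l)
  n∣[1+l]binom zero l = divides 0ℤ (trans (cong (λ z → (1ℤ + + l) * z) (n<k⇒binom≡0 {0} {suc l} z<s)) (*-zeroʳ (1ℤ + + l)))
  n∣[1+l]binom (suc n) l = divides (binom n l) (trans (absorption n l) (*-comm (1ℤ + + n) (binom n l)))

  -- The shape comes from (4k+3) C(k,l) = 4(l+1) C(k,l+1) + (4l+3) C(k,l) and the hockey-stick
  -- identity. The proof is a direct induction on n.
  ∑-linear-weight : ∀ n l → ∑ n (λ k → linearWeight k * binom k l) ≡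
    + 4 * (1ℤ + + l) * binom n (2 ℕ.+ l) + (+ 4 * + l + + 3) * binom n (suc l)
  ∑-linear-weight zero l = sym (trans
    (cong₂ (λ y z → + 4 * (1ℤ + + l) * y + (+ 4 * + l + + 3) * z)
      (n<k⇒binom≡0 {0} {2 ℕ.+ l} z<s) (n<k⇒binom≡0 {0} {suc l} z<s))
    (zeros (+ 4 * (1ℤ + + l)) (+ 4 * + l + + 3)))
    where
    zeros : ∀ a b → a * 0ℤ + b * 0ℤ ≡ 0ℤ
    zeros = solve-∀
  ∑-linear-weight (suc n) l = begin
    ∑ n (λ k → linearWeight k * binom k l) + linearWeight n * x₀
      ≡⟨ cong₂ (λ y z → y + z * x₀) (∑-linear-weight n l) (cong (λ z → z + + 3) (pos-* 4 n)) ⟩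
    + 4 * (1ℤ + + l) * x₂ + (+ 4 * + l + + 3) * x₁ + (+ 4 * + n + + 3) * x₀
      ≡⟨ by-adding (+ 4) (binom-sucʳ n l) (identity (+ n) (+ l) x₀ x₁ x₂) ⟩
    + 4 * (1ℤ + + l) * (x₁ + x₂) + (+ 4 * + l + + 3) * (x₀ + x₁)
      ≡⟨ cong₂ (λ y z → + 4 * (1ℤ + + l) * y + (+ 4 * + l + + 3) * z) (pascal n (suc l)) (pascal n l) ⟨
    + 4 * (1ℤ + + l) * binom (suc n) (2 ℕ.+ l) + (+ 4 * + l + + 3) * binom (suc n) (suc l) ∎
    where
    x₀ = binom n l
    x₁ = binom n (suc l)
    x₂ = binom n (2 ℕ.+ l)
    identity : ∀ n l x₀ x₁ x₂ →
      + 4 * (1ℤ + l) * x₂ + (+ 4 * l + + 3) * x₁ + (+ 4 * n + + 3) * x₀ + + 4 * ((1ℤ + l) * x₁) ≡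
      + 4 * (1ℤ + l) * (x₁ + x₂) + (+ 4 * l + + 3) * (x₀ + x₁) + + 4 * ((n - l) * x₀)
    identity = solve-∀

  -- As for the linear weight, with k C(k,l) = (l+1) C(k,l+1) + l C(k,l) applied twice to expand the
  -- k² term.
  ∑-quadratic-weight : ∀ n l → ∑ n (λ k → quadraticWeight k * binom k l) ≡
    + 8 * (1ℤ + + l) * (+ 2 + + l) * binom n (3 ℕ.+ l) + (+ 16 * + l + + 20) * (1ℤ + + l) * binom n (2 ℕ.+ l)
    + (+ 8 * + l * + l + + 12 * + l + + 5) * binom n (suc l)
  ∑-quadratic-weight zero l = sym (trans
    (cong₂ _+_
      (cong₂ (λ y z → + 8 * (1ℤ + + l) * (+ 2 + + l) * y + (+ 16 * + l + + 20) * (1ℤ + + l) * z)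
        (n<k⇒binom≡0 {0} {3 ℕ.+ l} z<s) (n<k⇒binom≡0 {0} {2 ℕ.+ l} z<s))
      (cong (λ z → (+ 8 * + l * + l + + 12 * + l + + 5) * z) (n<k⇒binom≡0 {0} {suc l} z<s)))
    (zeros (+ 8 * (1ℤ + + l) * (+ 2 + + l)) ((+ 16 * + l + + 20) * (1ℤ + + l)) (+ 8 * + l * + l + + 12 * + l + + 5)))
    where
    zeros : ∀ a b c → a * 0ℤ + b * 0ℤ + c * 0ℤ ≡ 0ℤ
    zeros = solve-∀
  ∑-quadratic-weight (suc n) l = begin
    ∑ n (λ k → quadraticWeight k * binom k l) + quadraticWeight n * x₀
      ≡⟨ cong₂ (λ y z → y + z * x₀) (∑-quadratic-weight n l) pos-weight ⟩
    a * x₃ + b * x₂ + c * x₁ + (+ 8 * (+ n * + n) + + 12 * + n + + 5) * x₀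
      -- The first relation trades (l+2) `x₂` for (n-l-1) `x₁`. The second multiplier is the total
      -- coefficient of (l+1) `x₁` after that trade.
      ≡⟨ by-adding (+ 8 * (1ℤ + + l)) (binom-sucʳ n (suc l))
           (by-adding (+ 8 * (+ n - + l - 1ℤ) + + 16 * + l + + 20) (binom-sucʳ n l)
             (identity (+ n) (+ l) x₀ x₁ x₂ x₃)) ⟩
    a * (x₂ + x₃) + b * (x₁ + x₂) + c * (x₀ + x₁)
      ≡⟨ cong₂ _+_ (cong₂ (λ y z → a * y + b * z) (pascal n (2 ℕ.+ l)) (pascal n (suc l)))
           (cong (λ z → c * z) (pascal n l)) ⟨
    a * binom (suc n) (3 ℕ.+ l) + b * binom (suc n) (2 ℕ.+ l) + c * binom (suc n) (suc l) ∎
    where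
    a = + 8 * (1ℤ + + l) * (+ 2 + + l)
    b = (+ 16 * + l + + 20) * (1ℤ + + l)
    c = + 8 * + l * + l + + 12 * + l + + 5
    x₀ = binom n l
    x₁ = binom n (suc l)
    x₂ = binom n (2 ℕ.+ l)
    x₃ = binom n (3 ℕ.+ l)
    pos-weight : quadraticWeight n ≡ + 8 * (+ n * + n) + + 12 * + n + + 5
    pos-weight = cong₂ (λ y z → y + z + + 5)
      (trans (pos-* 8 (n ℕ.^ 2)) (cong (λ z → + 8 * z) (trans (pos-* n (n ℕ.* 1)) (cong (λ z → + n * + z) (ℕ.*-identityʳ n)))))
      (pos-* 12 n)
    identity : ∀ n l x₀ x₁ x₂ x₃ →
      + 8 * (1ℤ + l) * (+ 2 + l) * x₃ + (+ 16 * l + + 20) * (1ℤ + l) * x₂ + (+ 8 * l * l + + 12 * l + + 5) * x₁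
      + (+ 8 * (n * n) + + 12 * n + + 5) * x₀
      + + 8 * (1ℤ + l) * ((1ℤ + (1ℤ + l)) * x₂)
      + (+ 8 * (n - l - 1ℤ) + + 16 * l + + 20) * ((1ℤ + l) * x₁) ≡
      + 8 * (1ℤ + l) * (+ 2 + l) * (x₂ + x₃) + (+ 16 * l + + 20) * (1ℤ + l) * (x₁ + x₂)
      + (+ 8 * l * l + + 12 * l + + 5) * (x₀ + x₁)
      + + 8 * (1ℤ + l) * ((n - (1ℤ + l)) * x₁)
      + (+ 8 * (n - l - 1ℤ) + + 16 * l + + 20) * ((n - l) * x₀)
    identity = solve-∀

  -- Since n divides (l+j) C(n,l+j) for j ≥ 1, the coefficient of C(n,l+j) may be evaluated at l =
  -- -j: 4l+3 gives -1 and 4(l+1) gives -4. The zero term gives both weights the same three-term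
  -- form.
  n∣∑-linear-weight : ∀ n l → + n ∣ ∑ n (λ k → linearWeight k * binom k l) -
    (-1ℤ * binom n (suc l) + - + 4 * binom n (2 ℕ.+ l) + 0ℤ * binom n (3 ℕ.+ l))
  n∣∑-linear-weight n l = ∣-respʳ-≡
    (trans (cong (λ z → z - (-1ℤ * binom n (suc l) + - + 4 * binom n (2 ℕ.+ l) + 0ℤ * binom n (3 ℕ.+ l)))
      (∑-linear-weight n l))
      (identity (+ l) (binom n (suc l)) (binom n (2 ℕ.+ l)) (binom n (3 ℕ.+ l))))
    (∣m∣n⇒∣m+n (∣n⇒∣m*n (+ 4) (n∣[1+l]binom n (suc l))) (∣n⇒∣m*n (+ 4) (n∣[1+l]binom n l)))
    where
    identity : ∀ l x₁ x₂ x₃ →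
      + 4 * (1ℤ + l) * x₂ + (+ 4 * l + + 3) * x₁ - (-1ℤ * x₁ + - + 4 * x₂ + 0ℤ * x₃) ≡
      + 4 * ((1ℤ + (1ℤ + l)) * x₂) + + 4 * ((1ℤ + l) * x₁)
    identity = solve-∀

  -- The constants 1, 12 and 16 are the coefficients in `∑-quadratic-weight` evaluated at l = -1, -2
  -- and -3 respectively.
  n∣∑-quadratic-weight : ∀ n l → + n ∣ ∑ n (λ k → quadraticWeight k * binom k l) -
    (1ℤ * binom n (suc l) + + 12 * binom n (2 ℕ.+ l) + + 16 * binom n (3 ℕ.+ l))
  n∣∑-quadratic-weight n l = ∣-respʳ-≡
    (trans (cong (λ z → z - (1ℤ * binom n (suc l) + + 12 * binom n (2 ℕ.+ l) + + 16 * binom n (3 ℕ.+ l)))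
      (∑-quadratic-weight n l))
      (identity (+ l) (binom n (suc l)) (binom n (2 ℕ.+ l)) (binom n (3 ℕ.+ l))))
    (∣m∣n⇒∣m+n
      (∣m∣n⇒∣m+n
        (∣n⇒∣m*n (+ 8 * + l) (n∣[1+l]binom n (2 ℕ.+ l)))
        (∣n⇒∣m*n (+ 4 * (+ 4 * + l + 1ℤ)) (n∣[1+l]binom n (suc l))))
      (∣n⇒∣m*n (+ 4 * (+ 2 * + l + 1ℤ)) (n∣[1+l]binom n l)))
    where
    identity : ∀ l x₁ x₂ x₃ →
      + 8 * (1ℤ + l) * (+ 2 + l) * x₃ + (+ 16 * l + + 20) * (1ℤ + l) * x₂ + (+ 8 * l * l + + 12 * l + + 5) * x₁
      - (1ℤ * x₁ + + 12 * x₂ + + 16 * x₃) ≡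
      + 8 * l * ((1ℤ + (1ℤ + (1ℤ + l))) * x₃) + + 4 * (+ 4 * l + 1ℤ) * ((1ℤ + (1ℤ + l)) * x₂)
      + + 4 * (+ 2 * l + 1ℤ) * ((1ℤ + l) * x₁)
    identity = solve-∀

  -- Congruences between Newton coefficients.

  module _ (m l : ℕ) where

    private
      μ = + m
      N = + (2 ℕ.+ l)
      W = binom (suc l) m
      V = binom l m
      X = binom (2 ℕ.* m) (suc l)
      U = binom (2 ℕ.* m) l

    -- This and the next two congruences put l ≡ -2 into recurrences between neighbouring binomials;
    -- the witness is the quotient by l+2.
    N∣V-[m+1]W : N ∣ V - (μ + 1ℤ) * W
    N∣V-[m+1]W = divides (V - W) (by-adding -1ℤ (binom-sucˡ l m) (identity μ (+ l) V W))
      where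
      identity : ∀ μ l v w → v - (μ + 1ℤ) * w + -1ℤ * ((1ℤ + l - μ) * w) ≡
        (v - w) * (+ 2 + l) + -1ℤ * ((1ℤ + l) * v)
      identity = solve-∀

    N∣X+[2m+2]U : N ∣ X + (+ 2 * μ + + 2) * U
    N∣X+[2m+2]U = divides (X + U) (by-adding 1ℤ (binom-sucʳ (2 ℕ.* m) l) (identity μ (+ l) X U))
      where
      identity : ∀ μ l x u → x + (+ 2 * μ + + 2) * u + 1ℤ * ((1ℤ + l) * x) ≡
        (x + u) * (+ 2 + l) + 1ℤ * ((μ + (μ + 0ℤ) - l) * u)
      identity = solve-∀

    N∣[2m+1]X : N ∣ (+ 2 * μ + 1ℤ) * X
    N∣[2m+1]X = divides (X + X′) (by-adding 1ℤ (binom-sucʳ (2 ℕ.* m) (suc l)) (identity μ (+ l) X X′))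
      where
      X′ = binom (2 ℕ.* m) (2 ℕ.+ l)
      identity : ∀ μ l x y → (+ 2 * μ + 1ℤ) * x + 1ℤ * ((1ℤ + (1ℤ + l)) * y) ≡
        (x + y) * (+ 2 + l) + 1ℤ * ((μ + (μ + 0ℤ) - (1ℤ + l)) * x)
      identity = solve-∀

    -- Modulo l+2, 4V²U ≡ 4(m+1)²W²U ≡ -2(m+1)W²X, so the sum is -(2m+1)W²X ≡ 0.
    newton-step-∣ : N ∣ newton m (suc l) + + 4 * newton m l
    newton-step-∣ = ∣-respʳ-≡ (identity μ W V X U)
      (∣m∣n⇒∣m-n
        (∣m∣n⇒∣m+n (∣n⇒∣m*n (+ 4 * U * (V + (μ + 1ℤ) * W)) N∣V-[m+1]W)
                   (∣n⇒∣m*n (+ 2 * (μ + 1ℤ) * (W * W)) N∣X+[2m+2]U))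
        (∣n⇒∣m*n (W * W) N∣[2m+1]X))
      where
      identity : ∀ μ w v x u → w * w * x + + 4 * (v * v * u) ≡
        + 4 * u * (v + (μ + 1ℤ) * w) * (v - (μ + 1ℤ) * w)
        + + 2 * (μ + 1ℤ) * (w * w) * (x + (+ 2 * μ + + 2) * u)
        - w * w * ((+ 2 * μ + 1ℤ) * x)
      identity = solve-∀

  -- The quantity that telescopes in m; the factor m² makes it vanish at m = 0.
  square-newton : ℕ → ℕ → ℤ
  square-newton m l = + m * + m * newton m l

  module _ (m l : ℕ) where

    private
      μ = + m
      N = + (3 ℕ.+ l)
      W = binom (2 ℕ.+ l) m
      W′ = binom (2 ℕ.+ l) (suc m)
      V = binom (suc l) m
      P = binom l m
      X = binom (2 ℕ.* m) (2 ℕ.+ l)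
      X′ = binom (2 ℕ.* suc m) (2 ℕ.+ l)
      U = binom (2 ℕ.* m) (suc l)
      Y = binom (2 ℕ.* m) l

    -- Here the modulus is l+3. This and the next two congruences put l ≡ -3 into recurrences
    -- between neighbouring binomials.
    N∣2P-[m+2]V : N ∣ + 2 * P - (μ + + 2) * V
    N∣2P-[m+2]V = divides (P - V) (by-adding -1ℤ (binom-sucˡ l m) (identity μ (+ l) P V))
      where
      identity : ∀ μ l p v → + 2 * p - (μ + + 2) * v + -1ℤ * ((1ℤ + l - μ) * v) ≡
        (p - v) * (+ 3 + l) + -1ℤ * ((1ℤ + l) * p)
      identity = solve-∀

    N∣2U+[2m+3]Y : N ∣ + 2 * U + (+ 2 * μ + + 3) * Y
    N∣2U+[2m+3]Y = divides (U + Y) (by-adding 1ℤ (binom-sucʳ (2 ℕ.* m) l) (identity μ (+ l) U Y))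
      where
      identity : ∀ μ l u y → + 2 * u + (+ 2 * μ + + 3) * y + 1ℤ * ((1ℤ + l) * u) ≡
        (u + y) * (+ 3 + l) + 1ℤ * ((μ + (μ + 0ℤ) - l) * y)
      identity = solve-∀

    N∣[m+1]W′+V : N ∣ (μ + 1ℤ) * W′ + V
    N∣[m+1]W′+V = divides V (by-adding -1ℤ (absorption (suc l) m) (identity μ (+ l) W′ V))
      where
      identity : ∀ μ l w v → (μ + 1ℤ) * w + v + -1ℤ * ((1ℤ + μ) * w) ≡ v * (+ 3 + l) + -1ℤ * ((1ℤ + (1ℤ + l)) * v)
      identity = solve-∀

    X′≡X+2U+Y : X′ ≡ X + + 2 * U + Y
    X′≡X+2U+Y = begin
      binom (2 ℕ.* suc m) (2 ℕ.+ l)                                ≡⟨ cong (λ s → binom s (2 ℕ.+ l)) (ℕ.*-suc 2 m) ⟩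
      binom (2 ℕ.+ 2 ℕ.* m) (2 ℕ.+ l)                              ≡⟨ pascal (suc (2 ℕ.* m)) (suc l) ⟩
      binom (suc (2 ℕ.* m)) (suc l) + binom (suc (2 ℕ.* m)) (2 ℕ.+ l)
        ≡⟨ cong₂ _+_ (pascal (2 ℕ.* m) l) (pascal (2 ℕ.* m) (suc l)) ⟩
      Y + U + (U + X)                                              ≡⟨ regroup X U Y ⟩
      X + + 2 * U + Y                                              ∎
      where
      regroup : ∀ x u y → y + u + (u + x) ≡ x + + 2 * u + y
      regroup = solve-∀

    -- Modulo l+3, both m²W² X ≡ V²X and (m+1)²W′² ≡ V², while 16P² ≡ 4(m+2)²V². What remains is V²
    -- (6U + (2m+3)(2m+5)Y - 2X), which reduces to -2V² (X + (2m+2)U) ≡ 0. The congruences of the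
    -- preceding module are used at `suc l`, where their modulus is also l+3.
    newton-telescope-∣ : N ∣ + 8 * newton m (suc l) + + 16 * newton m l
      - (square-newton m (2 ℕ.+ l) + square-newton (suc m) (2 ℕ.+ l))
    newton-telescope-∣ = ∣-respʳ-≡
      (trans (cong (λ z → + 8 * (V * V * U) + + 16 * (P * P * Y)
                          - (μ * μ * (W * W * X) + (1ℤ + μ) * (1ℤ + μ) * (W′ * W′ * z))) X′≡X+2U+Y)
             (identity μ W W′ V P X U Y))
      (∣m∣n⇒∣m+n (∣m∣n⇒∣m+n (∣m∣n⇒∣m+n (∣m∣n⇒∣m-n (∣m∣n⇒∣m+n
        (∣n⇒∣m*n ((+ 2 * μ + + 5) * (V * V)) N∣2U+[2m+3]Y)
        (∣n⇒∣m*n (+ 4 * Y * (+ 2 * P + (μ + + 2) * V)) N∣2P-[m+2]V))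
        (∣n⇒∣m*n (+ 2 * (V * V)) (N∣X+[2m+2]U m (suc l))))
        (∣n⇒∣m*n ((X + + 2 * U + Y) * (V - (μ + 1ℤ) * W′)) N∣[m+1]W′+V))
        (∣n⇒∣m*n (X * (V + (μ + 1ℤ) * W)) (N∣V-[m+1]W m (suc l))))
        (∣n⇒∣m*n (W * W) (N∣[2m+1]X m (suc l))))
      where
      identity : ∀ μ w w′ v p x u y →
        + 8 * (v * v * u) + + 16 * (p * p * y)
        - (μ * μ * (w * w * x) + (1ℤ + μ) * (1ℤ + μ) * (w′ * w′ * (x + + 2 * u + y))) ≡
        (+ 2 * μ + + 5) * (v * v) * (+ 2 * u + (+ 2 * μ + + 3) * y)
        + + 4 * y * (+ 2 * p + (μ + + 2) * v) * (+ 2 * p - (μ + + 2) * v)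
        - + 2 * (v * v) * (x + (+ 2 * μ + + 2) * u)
        + (x + + 2 * u + y) * (v - (μ + 1ℤ) * w′) * ((μ + 1ℤ) * w′ + v)
        + x * (v + (μ + 1ℤ) * w) * (v - (μ + 1ℤ) * w)
        + w * w * ((+ 2 * μ + 1ℤ) * x)
      identity = solve-∀

  1+l∣newton-linear : ∀ m l → + suc l ∣
    -1ℤ * newton m l + - + 4 * prev (newton m) l + 0ℤ * prev (prev (newton m)) l
  1+l∣newton-linear m zero = divides x (sym (*-identityʳ x))
    where
    x = -1ℤ * newton m 0 + - + 4 * 0ℤ + 0ℤ * 0ℤ
  1+l∣newton-linear m (suc l) = ∣-respʳ-≡
    (identity (newton m (suc l)) (newton m l) (prev (prev (newton m)) (suc l)))
    (∣n⇒∣m*n -1ℤ (newton-step-∣ m l))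
    where
    identity : ∀ x y z → -1ℤ * x + - + 4 * y + 0ℤ * z ≡ -1ℤ * (x + + 4 * y)
    identity = solve-∀

  -- C(2m,1) = 2m is even. This settles l = 1 in the quadratic case, where the modulus is 2 and
  -- a(m,l-2) is absent.
  2∣newton-1 : ∀ m → + 2 ∣ newton m 1
  2∣newton-1 m = divides (binom 1 m * binom 1 m * + m) (trans
    (cong (λ z → binom 1 m * binom 1 m * z) (binom-1 (2 ℕ.* m))) (identity (binom 1 m) (+ m)))
    where
    identity : ∀ x μ → x * x * (μ + (μ + 0ℤ)) ≡ x * x * μ * + 2
    identity = solve-∀

  1+l∣newton-quadratic : ∀ m l → + suc l ∣
    1ℤ * newton m l + + 12 * prev (newton m) l + + 16 * prev (prev (newton m)) l
    - (square-newton m l + square-newton (suc m) l)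
  1+l∣newton-quadratic m zero = divides x (sym (*-identityʳ x))
    where
    x = 1ℤ * newton m 0 + + 12 * 0ℤ + + 16 * 0ℤ - (square-newton m 0 + square-newton (suc m) 0)
  1+l∣newton-quadratic m (suc zero) = ∣m∣n⇒∣m-n
    (∣m∣n⇒∣m+n
      (∣m∣n⇒∣m+n (∣n⇒∣m*n 1ℤ (2∣newton-1 m)) (∣m⇒∣m*n (newton m 0) (divides (+ 6) refl)))
      (divides 0ℤ refl))
    (∣m∣n⇒∣m+n (∣n⇒∣m*n (+ m * + m) (2∣newton-1 m)) (∣n⇒∣m*n (+ suc m * + suc m) (2∣newton-1 (suc m))))
  -- The weights 1, 12, 16 split as 1, 4, 0 plus 0, 8, 16: the first part vanishes by
  -- `newton-step-∣`, the second is matched with the telescoping terms.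
  1+l∣newton-quadratic m (suc (suc l)) = ∣-respʳ-≡
    (identity (newton m (2 ℕ.+ l)) (newton m (suc l)) (newton m l)
      (square-newton m (2 ℕ.+ l) + square-newton (suc m) (2 ℕ.+ l)))
    (∣m∣n⇒∣m+n (newton-step-∣ m (suc l)) (newton-telescope-∣ m l))
    where
    identity : ∀ x y z t → 1ℤ * x + + 12 * y + + 16 * z - t ≡ x + + 4 * y + (+ 8 * y + + 16 * z - t)
    identity = solve-∀

  -- Weighted sums of the Sun coefficients modulo n.

  ∑-linear : ∀ n a b c (u v w : ℕ → ℤ) →
    ∑ n (λ l → a * u l + b * v l + c * w l) ≡ a * ∑ n u + b * ∑ n v + c * ∑ n w
  ∑-linear n a b c u v w = begin
    ∑ n (λ l → a * u l + b * v l + c * w l)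
      ≡⟨ ∑-+ n (λ l → a * u l + b * v l) (λ l → c * w l) ⟩
    ∑ n (λ l → a * u l + b * v l) + ∑ n (λ l → c * w l)
      ≡⟨ cong₂ _+_ (∑-+ n (λ l → a * u l) (λ l → b * v l)) (∑-*ˡ n c w) ⟩
    ∑ n (λ l → a * u l) + ∑ n (λ l → b * v l) + c * ∑ n w
      ≡⟨ cong (λ z → z + c * ∑ n w) (cong₂ _+_ (∑-*ˡ n a u) (∑-*ˡ n b v)) ⟩
    a * ∑ n u + b * ∑ n v + c * ∑ n w ∎

  -- Shifting l moves the offsets from the binomials to the coefficients. The boundary terms vanish
  -- because C(n,n+1) = C(n,n+2) = 0.
  ∑-prev-binom : ∀ n a b c (f : ℕ → ℤ) →
    ∑ n (λ l → f l * (a * binom n (suc l) + b * binom n (2 ℕ.+ l) + c * binom n (3 ℕ.+ l))) ≡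
    ∑ n (λ l → (a * f l + b * prev f l + c * prev (prev f) l) * binom n (suc l))
  ∑-prev-binom n a b c f = begin
    ∑ n (λ l → f l * (a * x l + b * x (suc l) + c * x (2 ℕ.+ l)))
      ≡⟨ ∑-cong n (λ {l} _ → expand (f l) a b c (x l) (x (suc l)) (x (2 ℕ.+ l))) ⟩
    ∑ n (λ l → a * (f l * x l) + b * (f l * x (suc l)) + c * (f l * x (2 ℕ.+ l)))
      ≡⟨ ∑-linear n a b c _ _ _ ⟩
    a * ∑ n (λ l → f l * x l) + b * ∑ n (λ l → f l * x (suc l)) + c * ∑ n (λ l → f l * x (2 ℕ.+ l))
      ≡⟨ cong₂ (λ y z → a * ∑ n (λ l → f l * x l) + b * y + c * z) shift shift² ⟩
    a * ∑ n (λ l → f l * x l) + b * ∑ n (λ l → prev f l * x l) + c * ∑ n (λ l → prev (prev f) l * x l)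
      ≡⟨ ∑-linear n a b c _ _ _ ⟨
    ∑ n (λ l → a * (f l * x l) + b * (prev f l * x l) + c * (prev (prev f) l * x l))
      ≡⟨ ∑-cong n (λ {l} _ → collect (f l) (prev f l) (prev (prev f) l) a b c (x l)) ⟨
    ∑ n (λ l → (a * f l + b * prev f l + c * prev (prev f) l) * x l) ∎
    where
    x : ℕ → ℤ
    x l = binom n (suc l)
    shift : ∑ n (λ l → f l * x (suc l)) ≡ ∑ n (λ l → prev f l * x l)
    shift = ∑-prev n f x (n<k⇒binom≡0 (ℕ.n<1+n n))
    shift² : ∑ n (λ l → f l * x (2 ℕ.+ l)) ≡ ∑ n (λ l → prev (prev f) l * x l)
    shift² = trans (∑-prev n f (λ l → x (suc l)) (n<k⇒binom≡0 (ℕ.m<n⇒m<1+n (ℕ.n<1+n n))))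
                   (∑-prev n (prev f) x (n<k⇒binom≡0 (ℕ.n<1+n n)))
    expand : ∀ f a b c x y z → f * (a * x + b * y + c * z) ≡ a * (f * x) + b * (f * y) + c * (f * z)
    expand = solve-∀
    collect : ∀ f g h a b c x → (a * f + b * g + c * h) * x ≡ a * (f * x) + b * (g * x) + c * (h * x)
    collect = solve-∀

  ∑-newton : ∀ m n (w : ℕ → ℤ) → ∑ n (λ k → w k * sunCoeff k m) ≡
    ∑ n (λ l → newton m l * ∑ n (λ k → w k * binom k l))
  ∑-newton m n w = begin
    ∑ n (λ k → w k * sunCoeff k m)
      ≡⟨ ∑-cong n (λ {k} k<n → trans (cong (λ z → w k * z) (newton-expansion m k<n)) (sym (∑-*ˡ n (w k) _))) ⟩
    ∑ n (λ k → ∑ n (λ l → w k * (newton m l * binom k l)))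
      ≡⟨ ∑-comm n n _ ⟩
    ∑ n (λ l → ∑ n (λ k → w k * (newton m l * binom k l)))
      ≡⟨ ∑-cong n (λ {l} _ → trans (∑-cong n (λ {k} _ → swap (w k) (newton m l) (binom k l)))
                                   (∑-*ˡ n (newton m l) (λ k → w k * binom k l))) ⟩
    ∑ n (λ l → newton m l * ∑ n (λ k → w k * binom k l)) ∎
    where
    swap : ∀ a b c → a * (b * c) ≡ b * (a * c)
    swap = solve-∀

  n∣∑-newton : ∀ m n a b c (w : ℕ → ℤ) →
    (∀ l → + n ∣ ∑ n (λ k → w k * binom k l) -
      (a * binom n (suc l) + b * binom n (2 ℕ.+ l) + c * binom n (3 ℕ.+ l))) →
    + n ∣ ∑ n (λ k → w k * sunCoeff k m) -
      ∑ n (λ l → (a * newton m l + b * prev (newton m) l + c * prev (prev (newton m)) l) * binom n (suc l))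
  n∣∑-newton m n a b c w n∣ = ∣-respʳ-≡ (begin
    ∑ n (λ k → w k * sunCoeff k m) - ∑ n (λ l → f l * binom n (suc l))
      ≡⟨ cong₂ _-_ (∑-newton m n w) (sym (∑-prev-binom n a b c (newton m))) ⟩
    ∑ n (λ l → newton m l * S l) - ∑ n (λ l → newton m l * T l)
      ≡⟨ ∑-- n _ _ ⟨
    ∑ n (λ l → newton m l * S l - newton m l * T l)
      ≡⟨ ∑-cong n (λ {l} _ → factor (newton m l) (S l) (T l)) ⟩
    ∑ n (λ l → newton m l * (S l - T l)) ∎)
    (∑-∣ (+ n) n (λ l → ∣n⇒∣m*n (newton m l) (n∣ l)))
    where
    f S T : ℕ → ℤ
    f l = a * newton m l + b * prev (newton m) l + c * prev (prev (newton m)) l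
    S l = ∑ n (λ k → w k * binom k l)
    T l = a * binom n (suc l) + b * binom n (2 ℕ.+ l) + c * binom n (3 ℕ.+ l)
    factor : ∀ a b c → a * b - a * c ≡ a * (b - c)
    factor = solve-∀

  -- A factor l+1 taken out of `f l` combines with C(n,l+1) into a multiple of n, by `n∣[1+l]binom`.
  n∣∑-binom : ∀ n {f : ℕ → ℤ} → (∀ l → + suc l ∣ f l) → + n ∣ ∑ n (λ l → f l * binom n (suc l))
  n∣∑-binom n {f} 1+l∣f = ∑-∣ (+ n) n term
    where
    term : ∀ l → + n ∣ f l * binom n (suc l)
    term l with 1+l∣f l
    ... | divides q fl≡q*[1+l] = ∣-respʳ-≡
      (trans (cong (λ z → z * binom n (suc l)) fl≡q*[1+l]) (*-assoc q (+ suc l) (binom n (suc l))))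
      (∣n⇒∣m*n q (n∣[1+l]binom n l))

  d∣x-y∧d∣y⇒d∣x : ∀ {d x y} → d ∣ x - y → d ∣ y → d ∣ x
  d∣x-y∧d∣y⇒d∣x {d} {x} {y} d∣x-y d∣y = ∣m+n∣n⇒∣m {d} {x} { - y} d∣x-y (∣m⇒∣-m d∣y)

  n∣∑-linear : ∀ m n →
    + n ∣ ∑ n (λ k → linearWeight k * sunCoeff k m)
  n∣∑-linear m n = d∣x-y∧d∣y⇒d∣x
    (n∣∑-newton m n -1ℤ (- + 4) 0ℤ linearWeight (n∣∑-linear-weight n)) (n∣∑-binom n (1+l∣newton-linear m))

  ∑-square-newton : ℕ → ℕ → ℤ
  ∑-square-newton n m = ∑ n (λ l → square-newton m l * binom n (suc l))

  -- For a single m the sum need not vanish modulo n: the terms `t l` survive, and they form two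
  -- consecutive values of `∑-square-newton n`, ready for the alternating sum over m.
  n∣∑-quadratic : ∀ m n →
    + n ∣ ∑ n (λ k → quadraticWeight k * sunCoeff k m)
      - (∑-square-newton n m + ∑-square-newton n (suc m))
  n∣∑-quadratic m n = ∣-respʳ-≡ split
    (∣m∣n⇒∣m+n (n∣∑-newton m n 1ℤ (+ 12) (+ 16) quadraticWeight (n∣∑-quadratic-weight n))
               (n∣∑-binom n (1+l∣newton-quadratic m)))
    where
    x s t : ℕ → ℤ
    x l = binom n (suc l)
    s l = 1ℤ * newton m l + + 12 * prev (newton m) l + + 16 * prev (prev (newton m)) l
    t l = square-newton m l + square-newton (suc m) l
    Y = ∑ n (λ k → quadraticWeight k * sunCoeff k m)
    distribute : ∀ a b c → (a - b) * c ≡ a * c - b * c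
    distribute = solve-∀
    distribute₊ : ∀ a b c → (a + b) * c ≡ a * c + b * c
    distribute₊ = solve-∀
    cancel : ∀ a b c → a - c ≡ a - b + (b - c)
    cancel = solve-∀
    split : Y - (∑-square-newton n m + ∑-square-newton n (suc m)) ≡
      Y - ∑ n (λ l → s l * x l) + ∑ n (λ l → (s l - t l) * x l)
    split = begin
      Y - (∑-square-newton n m + ∑-square-newton n (suc m))
        ≡⟨ cong (λ z → Y - z) (trans (∑-cong n (λ {l} _ → distribute₊ (square-newton m l) (square-newton (suc m) l) (x l)))
             (∑-+ n _ _)) ⟨
      Y - ∑ n (λ l → t l * x l)
        ≡⟨ cancel Y (∑ n (λ l → s l * x l)) (∑ n (λ l → t l * x l)) ⟩
      Y - ∑ n (λ l → s l * x l) + (∑ n (λ l → s l * x l) - ∑ n (λ l → t l * x l))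
        ≡⟨ cong (λ z → Y - ∑ n (λ l → s l * x l) + z)
             (trans (∑-cong n (λ {l} _ → distribute (s l) (t l) (x l))) (∑-- n _ _)) ⟨
      Y - ∑ n (λ l → s l * x l) + ∑ n (λ l → (s l - t l) * x l) ∎

  -- Coefficients and values of polynomials

  coeff-+ₚ : ∀ p q m → coeff (p +ₚ q) m ≡ coeff p m + coeff q m
  coeff-+ₚ []      q       m       = sym (+-identityˡ (coeff q m))
  coeff-+ₚ (a ∷ p) []      m       = sym (+-identityʳ (coeff (a ∷ p) m))
  coeff-+ₚ (a ∷ p) (b ∷ q) zero    = refl
  coeff-+ₚ (a ∷ p) (b ∷ q) (suc m) = coeff-+ₚ p q m

  coeff-·ₚ : ∀ c p m → coeff (c ·ₚ p) m ≡ c * coeff p m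
  coeff-·ₚ c []      m       = sym (*-zeroʳ c)
  coeff-·ₚ c (a ∷ p) zero    = refl
  coeff-·ₚ c (a ∷ p) (suc m) = coeff-·ₚ c p m

  coeff-∑ₚ : ∀ n (c : ℕ → ℤ) (p : ℕ → ℤ[x]) m → coeff (∑ₚ n (λ k → c k ·ₚ p k)) m ≡ ∑ n (λ k → c k * coeff (p k) m)
  coeff-∑ₚ zero    c p m = refl
  coeff-∑ₚ (suc n) c p m = trans (coeff-+ₚ (∑ₚ n (λ k → c k ·ₚ p k)) (c n ·ₚ p n) m)
    (cong₂ _+_ (coeff-∑ₚ n c p m) (coeff-·ₚ (c n) (p n) m))

  coeff-x^-diagonal : ∀ m → coeff (x^ m) m ≡ 1ℤ
  coeff-x^-diagonal zero    = refl
  coeff-x^-diagonal (suc m) = coeff-x^-diagonal m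

  coeff-x^-off-diagonal : ∀ j m → j ≢ m → coeff (x^ j) m ≡ 0ℤ
  coeff-x^-off-diagonal zero    zero    j≢m = contradiction refl j≢m
  coeff-x^-off-diagonal zero    (suc m) j≢m = refl
  coeff-x^-off-diagonal (suc j) zero    j≢m = refl
  coeff-x^-off-diagonal (suc j) (suc m) j≢m = coeff-x^-off-diagonal j m (λ j≡m → j≢m (cong suc j≡m))

  ∑-coeff-x^ : ∀ {m n} (c : ℕ → ℤ) → m ℕ.< n → ∑ n (λ j → c j * coeff (x^ j) m) ≡ c m
  ∑-coeff-x^ {m} {suc n} c m<1+n with ℕ.m<1+n⇒m<n∨m≡n m<1+n
  ... | inj₁ m<n = begin
    ∑ n (λ j → c j * coeff (x^ j) m) + c n * coeff (x^ n) m
      ≡⟨ cong₂ (λ y z → y + c n * z) (∑-coeff-x^ c m<n) (coeff-x^-off-diagonal n m (ℕ.>⇒≢ m<n)) ⟩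
    c m + c n * 0ℤ
      ≡⟨ cong (λ z → c m + z) (*-zeroʳ (c n)) ⟩
    c m + 0ℤ
      ≡⟨ +-identityʳ (c m) ⟩
    c m ∎
  ... | inj₂ refl = begin
    ∑ m (λ j → c j * coeff (x^ j) m) + c m * coeff (x^ m) m
      ≡⟨ cong₂ (λ y z → y + c m * z)
           (∑-zero m (λ {j} j<m → trans (cong (λ z → c j * z) (coeff-x^-off-diagonal j m (ℕ.<⇒≢ j<m))) (*-zeroʳ (c j))))
           (coeff-x^-diagonal m) ⟩
    0ℤ + c m * 1ℤ
      ≡⟨ +-identityˡ (c m * 1ℤ) ⟩
    c m * 1ℤ
      ≡⟨ *-identityʳ (c m) ⟩
    c m ∎

  eval-+ₚ : ∀ p q t → eval (p +ₚ q) t ≡ eval p t + eval q t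
  eval-+ₚ []      q       t = sym (+-identityˡ (eval q t))
  eval-+ₚ (a ∷ p) []      t = sym (+-identityʳ (eval (a ∷ p) t))
  eval-+ₚ (a ∷ p) (b ∷ q) t =
    trans (cong (λ z → a + b + t * z) (eval-+ₚ p q t)) (regroup a b t (eval p t) (eval q t))
    where
    regroup : ∀ a b t x y → a + b + t * (x + y) ≡ a + t * x + (b + t * y)
    regroup = solve-∀

  eval-·ₚ : ∀ c p t → eval (c ·ₚ p) t ≡ c * eval p t
  eval-·ₚ c []      t = sym (*-zeroʳ c)
  eval-·ₚ c (a ∷ p) t = trans (cong (λ z → c * a + t * z) (eval-·ₚ c p t)) (regroup c a t (eval p t))
    where
    regroup : ∀ c a t x → c * a + t * (c * x) ≡ c * (a + t * x)
    regroup = solve-∀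

  eval-x^ : ∀ j t → eval (x^ j) t ≡ t ^ j
  eval-x^ zero    t = trans (cong (λ z → 1ℤ + z) (*-zeroʳ t)) (+-identityʳ 1ℤ)
  eval-x^ (suc j) t = trans (+-identityˡ (t * eval (x^ j) t)) (cong (λ z → t * z) (eval-x^ j t))

  eval-∑ₚ : ∀ n (c : ℕ → ℤ) t → eval (∑ₚ n (λ j → c j ·ₚ x^ j)) t ≡ ∑ n (λ j → c j * t ^ j)
  eval-∑ₚ zero    c t = refl
  eval-∑ₚ (suc n) c t = trans (eval-+ₚ (∑ₚ n (λ j → c j ·ₚ x^ j)) (c n ·ₚ x^ n) t)
    (cong₂ _+_ (eval-∑ₚ n c t) (trans (eval-·ₚ (c n) (x^ n) t) (cong (λ z → c n * z) (eval-x^ n t))))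

  -- The Sun polynomials: coefficients, values and divisibility.

  sunCoeff-def : ∀ k j → + ((k C j) ℕ.^ 2 ℕ.* ((2 ℕ.* j) C j)) ≡ sunCoeff k j
  sunCoeff-def k j = begin
    + ((k C j) ℕ.^ 2 ℕ.* ((2 ℕ.* j) C j))
      ≡⟨ pos-* ((k C j) ℕ.^ 2) ((2 ℕ.* j) C j) ⟩
    + ((k C j) ℕ.* ((k C j) ℕ.* 1)) * + ((2 ℕ.* j) C j)
      ≡⟨ cong (λ z → z * + ((2 ℕ.* j) C j))
           (trans (cong (λ z → + ((k C j) ℕ.* z)) (ℕ.*-identityʳ (k C j))) (pos-* (k C j) (k C j))) ⟩
    + (k C j) * + (k C j) * + ((2 ℕ.* j) C j)
      ≡⟨ *-comm (+ (k C j) * + (k C j)) (+ ((2 ℕ.* j) C j)) ⟩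
    + ((2 ℕ.* j) C j) * (+ (k C j) * + (k C j))
      ≡⟨ cong₂ (λ y z → y * (z * z)) (binom-def (2 ℕ.* j) j) (binom-def k j) ⟨
    sunCoeff k j ∎

  coeff-g : ∀ k m → coeff (g k) m ≡ sunCoeff k m
  coeff-g k m = begin
    coeff (g k) m
      ≡⟨ coeff-∑ₚ (suc k) (λ j → + ((k C j) ℕ.^ 2 ℕ.* ((2 ℕ.* j) C j))) x^_ m ⟩
    ∑ (suc k) (λ j → + ((k C j) ℕ.^ 2 ℕ.* ((2 ℕ.* j) C j)) * coeff (x^ j) m)
      ≡⟨ ∑-cong (suc k) (λ {j} _ → cong (λ z → z * coeff (x^ j) m) (sunCoeff-def k j)) ⟩
    ∑ (suc k) (λ j → sunCoeff k j * coeff (x^ j) m)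
      -- The range is enlarged to contain m even when m > k; the added terms have j > k and vanish.
      ≡⟨ ∑-extend (λ j → sunCoeff k j * coeff (x^ j) m) (ℕ.m≤m+n (suc k) (suc m))
           (λ {j} k<j → cong (λ z → z * coeff (x^ j) m) (k<j⇒sunCoeff≡0 k<j)) ⟩
    ∑ (suc k ℕ.+ suc m) (λ j → sunCoeff k j * coeff (x^ j) m)
      ≡⟨ ∑-coeff-x^ (sunCoeff k) (ℕ.m≤n+m (suc m) (suc k)) ⟩
    sunCoeff k m ∎

  -- Padding with zero terms gives all k < n a common range for j, so that the sums over k and j can
  -- be interchanged.
  eval-g : ∀ {k n} t → k ℕ.< n → eval (g k) t ≡ ∑ n (λ j → sunCoeff k j * t ^ j)
  eval-g {k} {n} t k<n = begin
    eval (g k) t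
      ≡⟨ eval-∑ₚ (suc k) (λ j → + ((k C j) ℕ.^ 2 ℕ.* ((2 ℕ.* j) C j))) t ⟩
    ∑ (suc k) (λ j → + ((k C j) ℕ.^ 2 ℕ.* ((2 ℕ.* j) C j)) * t ^ j)
      ≡⟨ ∑-cong (suc k) (λ {j} _ → cong (λ z → z * t ^ j) (sunCoeff-def k j)) ⟩
    ∑ (suc k) (λ j → sunCoeff k j * t ^ j)
      ≡⟨ ∑-extend (λ j → sunCoeff k j * t ^ j) k<n (λ {j} k<j → cong (λ z → z * t ^ j) (k<j⇒sunCoeff≡0 k<j)) ⟩
    ∑ n (λ j → sunCoeff k j * t ^ j) ∎

  ∑-eval-g : ∀ n t (w : ℕ → ℤ) → ∑ n (λ k → w k * eval (g k) t) ≡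
    ∑ n (λ m → t ^ m * ∑ n (λ k → w k * sunCoeff k m))
  ∑-eval-g n t w = begin
    ∑ n (λ k → w k * eval (g k) t)
      ≡⟨ ∑-cong n (λ {k} k<n → trans (cong (λ z → w k * z) (eval-g t k<n)) (sym (∑-*ˡ n (w k) _))) ⟩
    ∑ n (λ k → ∑ n (λ m → w k * (c k m * t ^ m)))
      ≡⟨ ∑-comm n n _ ⟩
    ∑ n (λ m → ∑ n (λ k → w k * (c k m * t ^ m)))
      ≡⟨ ∑-cong n (λ {m} _ → trans (∑-cong n (λ {k} _ → rotate (w k) (c k m) (t ^ m)))
                                   (∑-*ˡ n (t ^ m) (λ k → w k * c k m))) ⟩
    ∑ n (λ m → t ^ m * ∑ n (λ k → w k * c k m)) ∎
    where
    c : ℕ → ℕ → ℤ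
    c k m = sunCoeff k m
    rotate : ∀ a b s → a * (b * s) ≡ s * (a * b)
    rotate = solve-∀

  -- After telescoping, the end m = 0 vanishes by the factor m², and the end m = n because a(n,l) =
  -- 0 for l < n.
  ∑-alternating-square-newton : ∀ n →
    ∑ n (λ m → -1ℤ ^ m * (∑-square-newton n m + ∑-square-newton n (suc m))) ≡ 0ℤ
  ∑-alternating-square-newton n = begin
    ∑ n (λ m → -1ℤ ^ m * (∑-square-newton n m + ∑-square-newton n (suc m)))
      ≡⟨ ∑-alternating n (∑-square-newton n) ⟩
    ∑-square-newton n 0 - -1ℤ ^ n * ∑-square-newton n n
      ≡⟨ cong₂ (λ y z → y - -1ℤ ^ n * z) (∑-zero n (λ _ → refl)) (∑-zero n vanish) ⟩
    0ℤ - -1ℤ ^ n * 0ℤ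
      ≡⟨ cong (λ z → 0ℤ - z) (*-zeroʳ (-1ℤ ^ n)) ⟩
    0ℤ ∎
    where
    vanish : ∀ {l} → l ℕ.< n → square-newton n l * binom n (suc l) ≡ 0ℤ
    vanish {l} l<n = cong (λ z → z * binom n (suc l))
      (trans (cong (λ z → + n * + n * z) (l<m⇒newton≡0 l<n)) (*-zeroʳ (+ n * + n)))

  n∣∑-linear-coeff : ∀ n m → + n ∣ coeff (∑ₚ n (λ k → linearWeight k ·ₚ g k)) m
  n∣∑-linear-coeff n m = ∣-respʳ-≡
    (trans (coeff-∑ₚ n linearWeight g m) (∑-cong n (λ {k} _ → cong (λ z → linearWeight k * z) (coeff-g k m))))
    (n∣∑-linear m n)

  n∣∑-quadratic-eval : ∀ n → + n ∣ ∑ n (λ k → quadraticWeight k * eval (g k) -1ℤ)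
  n∣∑-quadratic-eval n = ∣-respʳ-≡
    (begin
      ∑ n (λ k → quadraticWeight k * eval (g k) -1ℤ)
        ≡⟨ ∑-eval-g n -1ℤ quadraticWeight ⟩
      ∑ n (λ m → -1ℤ ^ m * Y m)
        -- Subtracting the vanishing alternating sum turns each summand into a multiple of a
        -- difference covered by `n∣∑-quadratic`.
        ≡⟨ +-identityʳ _ ⟨
      ∑ n (λ m → -1ℤ ^ m * Y m) - 0ℤ
        ≡⟨ cong (λ z → ∑ n (λ m → -1ℤ ^ m * Y m) - z) (∑-alternating-square-newton n) ⟨
      ∑ n (λ m → -1ℤ ^ m * Y m) - ∑ n (λ m → -1ℤ ^ m * Z m)
        ≡⟨ ∑-- n _ _ ⟨
      ∑ n (λ m → -1ℤ ^ m * Y m - -1ℤ ^ m * Z m)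
        ≡⟨ ∑-cong n (λ {m} _ → factor (-1ℤ ^ m) (Y m) (Z m)) ⟩
      ∑ n (λ m → -1ℤ ^ m * (Y m - Z m)) ∎)
    (∑-∣ (+ n) n (λ m → ∣n⇒∣m*n (-1ℤ ^ m) (n∣∑-quadratic m n)))
    where
    Y Z : ℕ → ℤ
    Y m = ∑ n (λ k → quadraticWeight k * sunCoeff k m)
    Z m = ∑-square-newton n m + ∑-square-newton n (suc m)
    factor : ∀ a b c → a * b - a * c ≡ a * (b - c)
    factor = solve-∀

open import Data.Integer.Base using (+_; -1ℤ) renaming (_*_ to _*ℤ_)
open import Data.Integer.Divisibility.Signed using (_∣_)
open import Data.Nat.Base using (ℕ; _+_; _*_; _^_; NonZero)
open import Data.Product.Base using (_×_; _,_)

theorem1 : (n : ℕ) → .{{_ : NonZero n}} →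
    ((m : ℕ) → + n ∣ coeff (∑ₚ n (λ k → + (4 * k + 3) ·ₚ g k)) m)
    × (+ n ∣ ∑ n (λ k → + (8 * k ^ 2 + 12 * k + 5) *ℤ eval (g k) -1ℤ))
theorem1 n = n∣∑-linear-coeff n , n∣∑-quadratic-eval n
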